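{- Let $p\ge2$ be an integer. Then the set of all $p$-adic permutations forms a subgroup of the group of all permutations of $\mathbb{Z}_p$ with respect to composition.
   Context: $p\ge2$ is an integer, not necessarily prime, and $\mathbb{Z}_p=\varprojlim \mathbb{Z}/p^k\mathbb{Z}$. A $p$-adic permutation is a permutation $\pi$ of $\mathbb{Z}_p$ such that $\pi(n)\equiv n\pmod p$ for all $n\in\mathbb{Z}_p$, and for all integers $k\ge1$ and all $m,n\in\mathbb{Z}_p$: $m\equiv n\pmod{p^k}\Leftrightarrow\pi(m)\equiv\pi(n)\pmod{p^k}$. -}

module Defs where

open import Algebra.Bundles using (CommutativeRing; Group; Semiring)
open import Data.Integer.Base using (ℤ; +_)
open import Data.Integer.Properties using (+-*-commutativeRing)
open import Data.Nat.Base as ℕ using (ℕ; suc)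
open import Data.Product.Base using (_×_; _,_)
open import Function.Base using (_∘_)
open import Function.Bundles using (Inverse; _⇔_)
import Function.Construct.Composition as Composition
import Function.Construct.Identity as Identity
import Function.Construct.Symmetry as Symmetry
open import Level using (Level; 0ℓ; _⊔_)
open import Relation.Binary.Bundles using (Setoid)
open import Relation.Binary.Definitions using (_Respects_)
import Relation.Binary.Reasoning.Setoid as SetoidReasoning
open import Relation.Unary using (Pred; _∈_)

private
  variable
    c ℓ : Level

------------------------------------------------------------------------
-- Congruences and quotients by principal ideals

module Congruence (R : CommutativeRing c ℓ) where

  open CommutativeRing R
  open Semiring semiring using (rawSemiring)
  open import Algebra.Definitions.RawSemiring rawSemiring using (_∣_)
  open import Algebra.Definitions.RawMagma *-rawMagma using (_∣ʳ_) renaming (_,_ to _,∣_)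
  open import Algebra.Properties.AbelianGroup +-abelianGroup
    using (⁻¹-involutive; ⁻¹-∙-comm)
  open import Algebra.Properties.CommutativeSemigroup +-commutativeSemigroup
    using (interchange)
  open import Algebra.Properties.Ring ring using (-‿distribˡ-*; -‿distribʳ-*)
  open SetoidReasoning setoid

  infix 4 _≡_[mod_]

  _≡_[mod_] : Carrier → Carrier → Carrier → Set (c ⊔ ℓ)
  x ≡ y [mod d ] = d ∣ (x - y)

  private
    -‿anti : ∀ x y → - (x - y) ≈ y - x
    -‿anti x y = begin
      - (x - y)      ≈⟨ ⁻¹-∙-comm x (- y) ⟨
      - x - - y      ≈⟨ +-congˡ (⁻¹-involutive y) ⟩
      - x + y        ≈⟨ +-comm (- x) y ⟩
      y - x          ∎

    telescope : ∀ x y z → (x - y) + (y - z) ≈ x - z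
    telescope x y z = begin
      (x - y) + (y - z)    ≈⟨ +-assoc x (- y) (y - z) ⟩
      x + (- y + (y - z))  ≈⟨ +-congˡ (+-assoc (- y) y (- z)) ⟨
      x + ((- y + y) - z)  ≈⟨ +-congˡ (+-congʳ (-‿inverseˡ y)) ⟩
      x + (0# - z)         ≈⟨ +-congˡ (+-identityˡ (- z)) ⟩
      x - z                ∎

    ∣-resp-≈ : ∀ {d x y} → x ≈ y → d ∣ x → d ∣ y
    ∣-resp-≈ x≈y (q ,∣ qd≈x) = q ,∣ trans qd≈x x≈y

    ∣-+ : ∀ {d x y} → d ∣ x → d ∣ y → d ∣ (x + y)
    ∣-+ {d} (q ,∣ e) (r ,∣ f) = (q + r) ,∣ trans (distribʳ d q r) (+-cong e f)

    ∣-neg : ∀ {d x} → d ∣ x → d ∣ (- x)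
    ∣-neg {d} (q ,∣ e) = (- q) ,∣ trans (sym (-‿distribˡ-* q d)) (-‿cong e)

    ∣-*ˡ : ∀ {d x} y → d ∣ x → d ∣ (y * x)
    ∣-*ˡ {d} y (q ,∣ e) = (y * q) ,∣ trans (*-assoc y q d) (*-congˡ e)

  module _ {d : Carrier} where

    ≈⇒≡[mod] : ∀ {x y} → x ≈ y → x ≡ y [mod d ]
    ≈⇒≡[mod] {x} {y} x≈y =
      0# ,∣ trans (zeroˡ d) (sym (trans (+-congʳ x≈y) (-‿inverseʳ y)))

    ≡[mod]-sym : ∀ {x y} → x ≡ y [mod d ] → y ≡ x [mod d ]
    ≡[mod]-sym {x} {y} = ∣-resp-≈ (-‿anti x y) ∘ ∣-neg

    ≡[mod]-trans : ∀ {x y z} → x ≡ y [mod d ] → y ≡ z [mod d ] → x ≡ z [mod d ]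
    ≡[mod]-trans {x} {y} {z} e f = ∣-resp-≈ (telescope x y z) (∣-+ e f)

    +-cong-mod : ∀ {x y u v} → x ≡ y [mod d ] → u ≡ v [mod d ] →
                 x + u ≡ y + v [mod d ]
    +-cong-mod {x} {y} {u} {v} e f = ∣-resp-≈ eq (∣-+ e f)
      where
      eq : (x - y) + (u - v) ≈ (x + u) - (y + v)
      eq = trans (interchange x (- y) u (- v)) (+-congˡ (⁻¹-∙-comm y v))

    neg-cong-mod : ∀ {x y} → x ≡ y [mod d ] → - x ≡ - y [mod d ]
    neg-cong-mod {x} {y} e = ∣-resp-≈ (sym (⁻¹-∙-comm x (- y))) (∣-neg e)

    private
      *-congˡ-mod : ∀ x {u v} → u ≡ v [mod d ] → x * u ≡ x * v [mod d ]
      *-congˡ-mod x {u} {v} e = ∣-resp-≈ eq (∣-*ˡ x e)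
        where
        eq : x * (u - v) ≈ x * u - x * v
        eq = trans (distribˡ x u (- v)) (+-congˡ (sym (-‿distribʳ-* x v)))

    *-cong-mod : ∀ {x y u v} → x ≡ y [mod d ] → u ≡ v [mod d ] →
                 x * u ≡ y * v [mod d ]
    *-cong-mod {x} {y} {u} {v} e f =
      ≡[mod]-trans (*-congˡ-mod x f)
        (≡[mod]-trans (≈⇒≡[mod] (*-comm x v))
          (≡[mod]-trans (*-congˡ-mod v e) (≈⇒≡[mod] (*-comm v y))))

  -- The quotient R / dR: the same carrier, with congruence modulo d as
  -- its equality.
  quotient : Carrier → CommutativeRing c (c ⊔ ℓ)
  quotient d = record
    { Carrier = Carrier
    ; _≈_ = λ x y → x ≡ y [mod d ]
    ; _+_ = _+_
    ; _*_ = _*_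
    ; -_  = -_
    ; 0#  = 0#
    ; 1#  = 1#
    ; isCommutativeRing = record
      { isRing = record
        { +-isAbelianGroup = record
          { isGroup = record
            { isMonoid = record
              { isSemigroup = record
                { isMagma = record
                  { isEquivalence = record
                    { refl  = ≈⇒≡[mod] refl
                    ; sym   = ≡[mod]-sym
                    ; trans = ≡[mod]-trans
                    }
                  ; ∙-cong = +-cong-mod
                  }
                ; assoc = λ x y z → ≈⇒≡[mod] (+-assoc x y z)
                }
              ; identity = (λ x → ≈⇒≡[mod] (+-identityˡ x))
                         , (λ x → ≈⇒≡[mod] (+-identityʳ x))
              }
            ; inverse = (λ x → ≈⇒≡[mod] (-‿inverseˡ x))
                      , (λ x → ≈⇒≡[mod] (-‿inverseʳ x))
            ; ⁻¹-cong = neg-cong-mod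
            }
          ; comm = λ x y → ≈⇒≡[mod] (+-comm x y)
          }
        ; *-cong     = *-cong-mod
        ; *-assoc    = λ x y z → ≈⇒≡[mod] (*-assoc x y z)
        ; *-identity = (λ x → ≈⇒≡[mod] (*-identityˡ x))
                     , (λ x → ≈⇒≡[mod] (*-identityʳ x))
        ; distrib    = (λ x y z → ≈⇒≡[mod] (distribˡ x y z))
                     , (λ x y z → ≈⇒≡[mod] (distribʳ x y z))
        }
      ; *-comm = λ x y → ≈⇒≡[mod] (*-comm x y)
      }
    }

------------------------------------------------------------------------
-- The ring of p-adic integers

ℤ/_ : ℕ → CommutativeRing 0ℓ 0ℓ
ℤ/ n = Congruence.quotient +-*-commutativeRing (+ n)

module _ (p : ℕ) where

  private
    module ℤ/p^ (k : ℕ) = CommutativeRing (ℤ/ (p ℕ.^ k))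

  -- An element of lim ℤ/pᵏ. The transition map ℤ/pᵏ⁺¹ → ℤ/pᵏ is the
  -- identity on representatives, so compatibility reads as follows. The
  -- index k = 0 contributes only the zero ring.
  record PAdicInteger : Set where
    field
      proj       : (k : ℕ) → ℤ/p^.Carrier k
      compatible : (k : ℕ) → ℤ/p^._≈_ k (proj (suc k)) (proj k)

  open PAdicInteger

  ℤₚ : CommutativeRing 0ℓ 0ℓ
  ℤₚ = record
    { Carrier = PAdicInteger
    ; _≈_ = λ x y → ∀ k → ℤ/p^._≈_ k (proj x k) (proj y k)
    ; _+_ = λ x y → record
      { proj       = λ k → ℤ/p^._+_ k (proj x k) (proj y k)
      ; compatible = λ k → ℤ/p^.+-cong k {proj x (suc k)} {proj x k}
                             {proj y (suc k)} {proj y k}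
                             (compatible x k) (compatible y k)
      }
    ; _*_ = λ x y → record
      { proj       = λ k → ℤ/p^._*_ k (proj x k) (proj y k)
      ; compatible = λ k → ℤ/p^.*-cong k {proj x (suc k)} {proj x k}
                             {proj y (suc k)} {proj y k}
                             (compatible x k) (compatible y k)
      }
    ; -_ = λ x → record
      { proj       = λ k → ℤ/p^.-_ k (proj x k)
      ; compatible = λ k → ℤ/p^.-‿cong k {proj x (suc k)} {proj x k}
                             (compatible x k)
      }
    ; 0# = record
      { proj       = λ k → ℤ/p^.0# k
      ; compatible = λ k → ℤ/p^.refl k {ℤ/p^.0# k}
      }
    ; 1# = record
      { proj       = λ k → ℤ/p^.1# k
      ; compatible = λ k → ℤ/p^.refl k {ℤ/p^.1# k}
      }
    ; isCommutativeRing = record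
      { isRing = record
        { +-isAbelianGroup = record
          { isGroup = record
            { isMonoid = record
              { isSemigroup = record
                { isMagma = record
                  { isEquivalence = record
                    { refl  = λ {x} k → ℤ/p^.refl k {proj x k}
                    ; sym   = λ {x} {y} x≈y k →
                        ℤ/p^.sym k {proj x k} {proj y k} (x≈y k)
                    ; trans = λ {x} {y} {z} x≈y y≈z k →
                        ℤ/p^.trans k {proj x k} {proj y k} {proj z k}
                          (x≈y k) (y≈z k)
                    }
                  ; ∙-cong = λ {x} {y} {u} {v} x≈y u≈v k →
                      ℤ/p^.+-cong k {proj x k} {proj y k} {proj u k} {proj v k}
                        (x≈y k) (u≈v k)
                  }
                ; assoc = λ x y z k → ℤ/p^.+-assoc k (proj x k) (proj y k) (proj z k)
                }
              ; identity = (λ x k → ℤ/p^.+-identityˡ k (proj x k))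
                         , (λ x k → ℤ/p^.+-identityʳ k (proj x k))
              }
            ; inverse = (λ x k → ℤ/p^.-‿inverseˡ k (proj x k))
                      , (λ x k → ℤ/p^.-‿inverseʳ k (proj x k))
            ; ⁻¹-cong = λ {x} {y} x≈y k →
                ℤ/p^.-‿cong k {proj x k} {proj y k} (x≈y k)
            }
          ; comm = λ x y k → ℤ/p^.+-comm k (proj x k) (proj y k)
          }
        ; *-cong = λ {x} {y} {u} {v} x≈y u≈v k →
            ℤ/p^.*-cong k {proj x k} {proj y k} {proj u k} {proj v k}
              (x≈y k) (u≈v k)
        ; *-assoc    = λ x y z k → ℤ/p^.*-assoc k (proj x k) (proj y k) (proj z k)
        ; *-identity = (λ x k → ℤ/p^.*-identityˡ k (proj x k))
                     , (λ x k → ℤ/p^.*-identityʳ k (proj x k))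
        ; distrib    = (λ x y z k → ℤ/p^.distribˡ k (proj x k) (proj y k) (proj z k))
                     , (λ x y z k → ℤ/p^.distribʳ k (proj x k) (proj y k) (proj z k))
        }
      ; *-comm = λ x y k → ℤ/p^.*-comm k (proj x k) (proj y k)
      }
    }

------------------------------------------------------------------------
-- Permutation groups and subgroups

module _ (S : Setoid c ℓ) where

  open Setoid S
  open Inverse using (to; from; to-cong; from-cong; strictlyInverseˡ; strictlyInverseʳ)

  -- The product f ∙ g is f ∘ g (apply g first).
  symmetricGroup : Group (c ⊔ ℓ) (c ⊔ ℓ)
  symmetricGroup = record
    { Carrier = Inverse S S
    ; _≈_ = λ f g → ∀ x → to f x ≈ to g x
    ; _∙_ = λ f g → Composition.inverse g f
    ; ε   = Identity.inverse S
    ; _⁻¹ = Symmetry.inverse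
    ; isGroup = record
      { isMonoid = record
        { isSemigroup = record
          { isMagma = record
            { isEquivalence = record
              { refl  = λ _ → refl
              ; sym   = λ f≈g x → sym (f≈g x)
              ; trans = λ f≈g g≈h x → trans (f≈g x) (g≈h x)
              }
            ; ∙-cong = λ {f} {_} {_} {v} f≈g u≈v x →
                trans (to-cong f (u≈v x)) (f≈g (to v x))
            }
          ; assoc = λ _ _ _ _ → refl
          }
        ; identity = (λ _ _ → refl) , (λ _ _ → refl)
        }
      ; inverse = strictlyInverseʳ , strictlyInverseˡ
      ; ⁻¹-cong = λ {f} {g} f≈g x →
          trans (from-cong f (sym (trans (f≈g (from g x)) (strictlyInverseˡ g x))))
                (strictlyInverseʳ f (from g x))
      }
    }

-- Since the equality of G is a setoid equality, a subset of G is a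
-- predicate that respects it.
record IsSubgroup {ℓ′} (G : Group c ℓ) (H : Pred (Group.Carrier G) ℓ′) :
                  Set (c ⊔ ℓ ⊔ ℓ′) where
  open Group G
  field
    resp-≈    : H Respects _≈_
    ε-closed  : ε ∈ H
    ∙-closed  : ∀ {x y} → x ∈ H → y ∈ H → (x ∙ y) ∈ H
    ⁻¹-closed : ∀ {x} → x ∈ H → (x ⁻¹) ∈ H

------------------------------------------------------------------------
-- p-adic permutations

module _ (p : ℕ) where

  open CommutativeRing (ℤₚ p) using (setoid; semiring; 1#)
  open Semiring semiring using (rawSemiring)
  open import Algebra.Definitions.RawSemiring rawSemiring using (_^_)
    renaming (_×_ to _·_)
  open Congruence (ℤₚ p) using (_≡_[mod_])

  permutationGroup : Group 0ℓ 0ℓ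
  permutationGroup = symmetricGroup setoid

  -- p as an element of ℤₚ.
  pₚ : PAdicInteger p
  pₚ = p · 1#

  IsPAdicPermutation : Pred (Group.Carrier permutationGroup) 0ℓ
  IsPAdicPermutation π =
    (∀ n → to n ≡ n [mod pₚ ]) ×
    (∀ k → 1 ℕ.≤ k → ∀ m n →
       (m ≡ n [mod pₚ ^ k ]) ⇔ (to m ≡ to n [mod pₚ ^ k ]))
    where open Inverse π using (to)

{-# OPTIONS --safe #-}
module Submission where

open import Defs
open import Algebra.Bundles using (CommutativeRing; Group; Semiring)
open import Data.Nat.Base using (ℕ; _≤_)
open import Data.Product.Base using (_,_)
open import Function.Bundles using (Inverse; _⇔_; mk⇔)
import Function.Construct.Composition as Composition
import Function.Construct.Identity as Identity
import Function.Construct.Symmetry as Symmetry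
open import Level using (Level; _⊔_)
open import Relation.Unary using (Pred)

-- The p-adic permutations are an intersection of subgroups of the permutation group: the
-- permutations that fix every residue class mod p and, for each k at least 1, those that preserve
-- and reflect congruence mod p^k. An intersection of subgroups is a subgroup. Each factor is a
-- subgroup over any commutative ring and any modulus `d`, since congruence mod `d` is an
-- equivalence relation containing the equality of the ring.

private
  variable
    c ℓ : Level

module _ (R : CommutativeRing c ℓ) (d : CommutativeRing.Carrier R) where

  open CommutativeRing R using (refl; setoid; sym)
  open Congruence R
  open Inverse using (to; from; strictlyInverseˡ)

  private
    Perm : Group (c ⊔ ℓ) (c ⊔ ℓ)
    Perm = symmetricGroup setoid

    ≡[mod]-cong-⇔ : ∀ {x x′ y y′} → x ≡ x′ [mod d ] → y ≡ y′ [mod d ] →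
                    (x ≡ y [mod d ]) ⇔ (x′ ≡ y′ [mod d ])
    ≡[mod]-cong-⇔ e f = mk⇔
      (λ g → ≡[mod]-trans (≡[mod]-sym e) (≡[mod]-trans g f))
      (λ g → ≡[mod]-trans e (≡[mod]-trans g (≡[mod]-sym f)))

  FixesResidues : Pred (Group.Carrier Perm) (c ⊔ ℓ)
  FixesResidues π = ∀ n → to π n ≡ n [mod d ]

  -- These are the permutations that descend to R/dR: one direction makes the induced map well
  -- defined, the other makes it injective.
  PreservesCongruence : Pred (Group.Carrier Perm) (c ⊔ ℓ)
  PreservesCongruence π =
    ∀ m n → (m ≡ n [mod d ]) ⇔ (to π m ≡ to π n [mod d ])

  -- For the inverse, evaluate the hypothesis at `from f n`, where `f` takes the value `n`, and use
  -- symmetry.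
  fixesResidues-isSubgroup : IsSubgroup Perm FixesResidues
  fixesResidues-isSubgroup = record
    { resp-≈    = λ f≈g fix n →
        ≡[mod]-trans (≈⇒≡[mod] (sym (f≈g n))) (fix n)
    ; ε-closed  = λ _ → ≈⇒≡[mod] refl
    ; ∙-closed  = λ {f} {g} fixf fixg n → ≡[mod]-trans (fixf (to g n)) (fixg n)
    ; ⁻¹-closed = λ {f} fix n →
        ≡[mod]-trans (≡[mod]-sym (fix (from f n)))
                     (≈⇒≡[mod] (strictlyInverseˡ f n))
    }

  preservesCongruence-isSubgroup : IsSubgroup Perm PreservesCongruence
  preservesCongruence-isSubgroup = record
    { resp-≈    = λ f≈g pres m n →
        Composition.equivalence (pres m n)
          (≡[mod]-cong-⇔ (≈⇒≡[mod] (f≈g m)) (≈⇒≡[mod] (f≈g n)))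
    ; ε-closed  = λ _ _ → Identity.equivalence _
    ; ∙-closed  = λ {f} {g} presf presg m n →
        Composition.equivalence (presg m n) (presf (to g m) (to g n))
    -- The hypothesis at the preimages of `m` and `n`, read backwards: this is where the condition
    -- must be an equivalence and not only an implication.
    ; ⁻¹-closed = λ {f} pres m n → Symmetry.equivalence
        (Composition.equivalence (pres (from f m) (from f n))
          (≡[mod]-cong-⇔ (≈⇒≡[mod] (strictlyInverseˡ f m))
                         (≈⇒≡[mod] (strictlyInverseˡ f n))))
    }

theorem3p19 : (p : ℕ) → 2 ≤ p → IsSubgroup (permutationGroup p) (IsPAdicPermutation p)
theorem3p19 p _ = record
  -- The intersection is handled componentwise: `Fix` is the factor for p, `Pres k` the factor for
  -- p^k.
  { resp-≈    = λ {f} {g} f≈g (fix , pres) →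
      Fix.resp-≈ {f} {g} f≈g fix ,
      λ k 1≤k → Pres.resp-≈ k {f} {g} f≈g (pres k 1≤k)
  ; ε-closed  = Fix.ε-closed , λ k _ → Pres.ε-closed k
  ; ∙-closed  = λ {f} {g} (fixf , presf) (fixg , presg) →
      Fix.∙-closed {f} {g} fixf fixg ,
      λ k 1≤k → Pres.∙-closed k {f} {g} (presf k 1≤k) (presg k 1≤k)
  ; ⁻¹-closed = λ {f} (fix , pres) →
      Fix.⁻¹-closed {f} fix ,
      λ k 1≤k → Pres.⁻¹-closed k {f} (pres k 1≤k)
  }
  where
  open CommutativeRing (ℤₚ p) using (semiring)
  open import Algebra.Definitions.RawSemiring (Semiring.rawSemiring semiring) using (_^_)
  module Fix = IsSubgroup (fixesResidues-isSubgroup (ℤₚ p) (pₚ p))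
  module Pres (k : ℕ) =
    IsSubgroup (preservesCongruence-isSubgroup (ℤₚ p) (pₚ p ^ k))
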